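{- Let $n\ge 3$ be an integer and let $K=\{123,132,231\}$. The number of equivalence classes of $S_n$ under $K$-equivalence is $2^{n-1}$.
   Context: Permutations in $S_n$ are written as words $\pi_1\pi_2\cdots\pi_n$ in one-line notation. The order permutation of a word $u$ of $c$ distinct positive integers is the unique $\sigma\in S_c$ with $\sigma_i<\sigma_j$ iff $u_i<u_j$. A replacement partition $K$ of $S_c$ is a set partition of $S_c$; it is denoted by listing its parts with the one-element parts (and outer brackets) omitted, so here $K$ is the set partition of $S_3$ whose only part of size greater than one is $\{123,132,231\}$. The $K$-equivalence on $S_n$ is the equivalence relation generated by: $\phi\equiv\psi$ whenever $\phi=aub$ and $\psi=avb$ (concatenations) for some possibly empty words $a,b$ and words $u,v$ of length $c$ (so $u,v$ occupy the same $c$ consecutive positions) such that the order permutations of $u$ and $v$ lie in the same part of $K$. All equivalence classes are counted, including one-element classes. -}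

module Defs where

open import Data.Fin.Base using (Fin; toℕ) renaming (_<_ to _<ᶠ_)
open import Data.Fin.Permutation using (Permutation′; _⟨$⟩ʳ_; _≈_)
open import Data.List.Base using (List; []; _∷_; _++_; tabulate)
open import Data.List.Membership.Propositional using (_∈_)
open import Data.List.Properties using (tabulate-cong)
open import Data.Nat.Base using (ℕ; suc; _<_)
open import Data.Product.Base using (_×_; _,_; Σ-syntax; ∃-syntax)
open import Data.Sum.Base using (_⊎_; inj₁; inj₂)
open import Data.Vec.Base using (Vec; lookup; toList)
open import Function.Bundles using (_⇔_; Bijection)
open import Level using (Level; 0ℓ; _⊔_)
open import Relation.Binary.Bundles using (Setoid)
open import Relation.Binary.Core using (Rel)
open import Relation.Binary.Definitions using (Symmetric; Transitive)
import Relation.Binary.Construct.Closure.Equivalence as EqClosure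
open import Relation.Binary.PropositionalEquality
  using (_≡_; refl; sym; trans; cong; subst)
import Relation.Binary.PropositionalEquality.Properties as ≡

Word : Set
Word = List ℕ

-- The letters of a permutation of Fin n are shifted by one, so that they run
-- over 1, …, n.
oneLine : ∀ {n} → Permutation′ n → Word
oneLine π = tabulate (λ i → suc (toℕ (π ⟨$⟩ʳ i)))

-- σ satisfies this for at most one permutation (up to _≈_), and for some
-- permutation exactly when the letters of u are distinct.
IsOrderPermutation : ∀ {c} → Vec ℕ c → Permutation′ c → Set
IsOrderPermutation u σ =
  ∀ i j → (σ ⟨$⟩ʳ i) <ᶠ (σ ⟨$⟩ʳ j) ⇔ lookup u i < lookup u j

-- A set partition of S_c, given by its relation "in the same part".
record ReplacementPartition (c : ℕ) : Set₁ where
  field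
    SamePart  : Rel (Permutation′ c) 0ℓ
    reflexive : ∀ {σ τ} → σ ≈ τ → SamePart σ τ
    symmetric : Symmetric SamePart
    transitive : Transitive SamePart

open ReplacementPartition

-- The partition all of whose parts are one-element sets, except for the one
-- part consisting of the permutations whose words are listed in P.
onePart : ∀ c → List Word → ReplacementPartition c
onePart c P = record
  { SamePart   = _∼_
  ; reflexive  = λ σ≈τ → inj₁ (tabulate-cong (λ i → cong (λ k → suc (toℕ k)) (σ≈τ i)))
  ; symmetric  = λ where
      (inj₁ e)       → inj₁ (sym e)
      (inj₂ (p , q)) → inj₂ (q , p)
  ; transitive = λ where
      (inj₁ e)       (inj₁ e′)      → inj₁ (trans e e′)
      (inj₁ e)       (inj₂ (p , q)) → inj₂ (subst (_∈ P) (sym e) p , q)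
      (inj₂ (p , q)) (inj₁ e)       → inj₂ (p , subst (_∈ P) e q)
      (inj₂ (p , _)) (inj₂ (_ , q)) → inj₂ (p , q)
  }
  where
  _∼_ : Rel (Permutation′ c) 0ℓ
  σ ∼ τ = oneLine σ ≡ oneLine τ ⊎ (oneLine σ ∈ P × oneLine τ ∈ P)

K : ReplacementPartition 3
K = onePart 3
  ( (1 ∷ 2 ∷ 3 ∷ [])
  ∷ (1 ∷ 3 ∷ 2 ∷ [])
  ∷ (2 ∷ 3 ∷ 1 ∷ [])
  ∷ [] )

Replacement : ∀ {c} → ReplacementPartition c → ∀ {n} → Rel (Permutation′ n) 0ℓ
Replacement {c} K φ ψ =
  ∃[ a ] ∃[ b ] Σ[ u ∈ Vec ℕ c ] Σ[ v ∈ Vec ℕ c ] ∃[ σ ] ∃[ τ ]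
      oneLine φ ≡ a ++ toList u ++ b
    × oneLine ψ ≡ a ++ toList v ++ b
    × IsOrderPermutation u σ
    × IsOrderPermutation v τ
    × SamePart K σ τ

-- Elements of Permutation′ n carry the inverse and proofs, so equality in S_n
-- is _≈_ rather than _≡_.  It is included among the generators so that the
-- closure is an equivalence relation on S_n also when n is less than c.
K-Equivalence : ∀ {c} → ReplacementPartition c → ℕ → Setoid 0ℓ 0ℓ
K-Equivalence K n =
  EqClosure.setoid {A = Permutation′ n} (λ φ ψ → φ ≈ ψ ⊎ Replacement K φ ψ)

-- S has exactly N equivalence classes.
ClassCount : ∀ {a ℓ : Level} → Setoid a ℓ → ℕ → Set (a ⊔ ℓ)
ClassCount S N = Bijection S (≡.setoid (Fin N))

{-# OPTIONS --safe #-}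
module Submission where

-- Call a word a valley if it first falls and then rises.  A valley on the
-- letters 1, …, n is determined by the set of letters of its falling arm, the
-- least letter included; this set contains 1, and its other members form an
-- arbitrary subset of {2, …, n}.  So there are 2 ^ (n ∸ 1) valleys in S_n, and
-- it suffices that every class contains exactly one of them.
--
-- Existence (normalise): 132 and 231 are the two patterns with a peak in the
-- middle, and 123 is the third member of the part, so K-equivalence allows
-- every peak x < y > z to be replaced by its sorted letters.  This lowers a
-- weight, and a word with distinct letters and without peaks is a valley.
--
-- Uniqueness: the word arm w, computed by inserting the letters of w from right
-- to left, is constant on classes (arm-∼) and is the falling arm when w is a
-- valley (valley-arm).  To insert x, delete the letters larger than x; put x in
-- front of the rest unless an odd number was deleted and the rest is nonempty.
-- The invariance comes down to two identities.  For a < b, inserting b and then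
-- a is inserting a with a changed parity (settle-absorb-larger), and inserting a
-- and then b with odd parity is inserting a alone (settle-odd-above).  By these,
-- each of the words abc, acb, bca with a < b < c acts in the same way as the
-- single letter a.
--
-- The class of π is recorded by the set of letters k + 2 in the arm of its word,
-- coded as an element of Fin (2 ^ m) where n = m + 1 (classOf).

open import Defs
open import Data.Bool.Base using (Bool; true; false; not; _xor_; if_then_else_)
open import Data.Bool.Properties using (xor-identityʳ; not-distribʳ-xor)
open import Data.Empty using (⊥; ⊥-elim)
open import Data.Fin.Base using (Fin; toℕ; fromℕ<; combine; finToFun; funToFin)
  renaming (zero to fzero; suc to fsuc; _<_ to _<ᶠ_)
import Data.Fin.Properties as Fin
open import Data.Fin.Patterns using (0F; 1F; 2F)
open import Data.Fin.Permutation
  using (Permutation′; _⟨$⟩ʳ_; _⟨$⟩ˡ_; inverseˡ; inverseʳ; _≈_; id; _∘ₚ_; lift₀; swap; transpose)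
open import Data.List.Base using (List; []; _∷_; _++_; _∷ʳ_; [_]; foldr; length; tabulate)
open import Data.Nat.Properties
open import Data.List.Membership.DecPropositional _≟_ using (_∈?_)
open import Data.List.Membership.Propositional using (_∈_; _∉_)
open import Data.List.Membership.Propositional.Properties
  using (∈-++⁺ˡ; ∈-++⁺ʳ; ∈-++⁻; ∈-tabulate⁺; ∈-tabulate⁻)
open import Data.List.Properties
  using (foldr-++; length-++; tabulate-cong; ∷-injectiveˡ; ∷-injectiveʳ)
open import Data.List.Relation.Binary.Permutation.Propositional
  using (_↭_; ↭-trans; ↭-prep; ↭-swap; ↭-refl)
open import Data.List.Relation.Binary.Permutation.Propositional.Properties
  using (++⁺ˡ; ∷↭∷ʳ; ++⁺ʳ)
open import Data.List.Relation.Binary.Subset.Propositional using (_⊆_)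
open import Data.List.Relation.Unary.All as All using (All; []; _∷_)
import Data.List.Relation.Unary.All.Properties as All
open import Data.List.Relation.Unary.AllPairs using (AllPairs; []; _∷_)
import Data.List.Relation.Unary.AllPairs.Properties as AllPairs
open import Data.List.Relation.Unary.Any using (Any; here; there)
open import Data.List.Relation.Unary.Linked as Linked using (Linked; []; [-]; _∷_)
open import Data.List.Relation.Unary.Linked.Properties using (Linked⇒AllPairs)
open import Data.List.Relation.Unary.Unique.Propositional using (Unique)
import Data.List.Relation.Unary.Unique.Propositional.Properties as Unique
open import Data.Nat.Base
  using (ℕ; zero; suc; _+_; _*_; _≤_; _<_; _>_; _∸_; _^_; z<s; s<s)
open import Data.Nat.Induction using (Acc; acc; <-wellFounded)
open import Data.Nat.Tactic.RingSolver using (solve-∀)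
open import Data.Product.Base using (_×_; _,_; ∃-syntax; Σ-syntax)
open import Data.Sum.Base using (_⊎_; inj₁; inj₂)
open import Data.Vec.Base as Vec using (Vec; lookup; toList)
open import Data.Vec.Membership.Propositional.Properties using (∈-lookup; ∈-toList⁺; ∈-toList⁻)
import Data.Vec.Relation.Unary.Any as VecAny
import Data.Vec.Relation.Unary.Any.Properties as VecAny
open import Function.Base using (_∘_)
open import Function.Bundles using (Inverse; Equivalence; mk⇔)
open import Level using (0ℓ)
open import Relation.Binary.Bundles using (Setoid)
import Relation.Binary.Construct.Closure.Equivalence as EqClosure
open import Relation.Binary.Core using (Rel)
open import Relation.Binary.Definitions using (Asymmetric; tri<; tri≈; tri>)
open import Relation.Binary.PropositionalEquality
  using (_≡_; _≢_; refl; sym; trans; cong; cong₂; subst; subst₂; module ≡-Reasoning)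
open import Relation.Binary.PropositionalEquality.Properties using (isEquivalence)
open import Relation.Nullary using (Dec; yes; no; does; contradiction)
open import Relation.Nullary.Decidable using (dec-true; dec-false; does-⇔)

------------------------------------------------------------------------
-- The invariant

-- Insertion of a letter x into the falling arm of a valley.  The flag p is true
-- when an odd number of letters larger than x has been deleted so far.
settle : Bool → ℕ → Word → Word
settle p x []      = [ x ]
settle p x (d ∷ s) with d <? x
... | yes _ = if p then d ∷ s else x ∷ d ∷ s
... | no  _ = settle (not p) x s

-- For a nonempty word w with distinct letters, the falling arm of the valley
-- equivalent to w, down to and including the least letter.
arm : Word → Word
arm = foldr (settle false) []

settle-smaller : ∀ {p x d} s → d < x → settle p x (d ∷ s) ≡ (if p then d ∷ s else x ∷ d ∷ s)
settle-smaller {x = x} {d} s d<x with d <? x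
... | yes _   = refl
... | no  d≮x = contradiction d<x d≮x

settle-larger : ∀ {p x d} s → x ≤ d → settle p x (d ∷ s) ≡ settle (not p) x s
settle-larger {x = x} {d} s x≤d with d <? x
... | yes d<x = contradiction d<x (≤⇒≯ x≤d)
... | no  _   = refl

-- With a < b, the letter a meets the letters larger than a that it would meet
-- without b, except for those deleted by b, and b itself if b was kept.  As b is
-- kept exactly when it deleted an even number of letters (counting by q), the two
-- effects together change the parity by a fixed amount.  If b is kept because
-- nothing was left, then a ends up alone and its parity does not matter.
settle-absorb-larger : ∀ p q {a b} s → a < b →
  settle p a (settle q b s) ≡ settle (not (p xor q)) a s
settle-absorb-larger p q [] a<b = settle-larger [] (<⇒≤ a<b)
settle-absorb-larger p q {a} {b} (d ∷ s) a<b with d <? b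
settle-absorb-larger p false (d ∷ s) a<b | yes d<b
  rewrite xor-identityʳ p = settle-larger (d ∷ s) (<⇒≤ a<b)
settle-absorb-larger false true (d ∷ s) a<b | yes d<b = refl
settle-absorb-larger true  true (d ∷ s) a<b | yes d<b = refl
settle-absorb-larger p q {a} {b} (d ∷ s) a<b | no d≮b = begin
  settle p a (settle (not q) b s)    ≡⟨ settle-absorb-larger p (not q) s a<b ⟩
  settle (not (p xor not q)) a s     ≡⟨ cong (λ r → settle (not r) a s) (sym (not-distribʳ-xor p q)) ⟩
  settle (not (not (p xor q))) a s   ≡⟨ settle-larger s (≤-trans (<⇒≤ a<b) (≮⇒≥ d≮b)) ⟨
  settle (not (p xor q)) a (d ∷ s)   ∎
  where open ≡-Reasoning

-- The result of inserting a starts with a letter that is at most a.  A further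
-- b > a therefore deletes nothing, and odd parity keeps it out.
settle-odd-above : ∀ p {a b} s → a < b → settle true b (settle p a s) ≡ settle p a s
settle-odd-above p [] a<b = settle-smaller [] a<b
settle-odd-above p {a} (d ∷ s) a<b with d <? a
settle-odd-above false (d ∷ s) a<b | yes d<a = settle-smaller (d ∷ s) a<b
settle-odd-above true  (d ∷ s) a<b | yes d<a = settle-smaller s (<-trans d<a a<b)
settle-odd-above p     (d ∷ s) a<b | no  _   = settle-odd-above (not p) s a<b

module _ {a b c} (a<b : a < b) (b<c : b < c) (w : Word) where

  arm-123 : arm (a ∷ b ∷ c ∷ w) ≡ arm (a ∷ w)
  arm-123 = trans (cong (settle false a) (settle-absorb-larger false false (arm w) b<c))
                  (settle-absorb-larger false true (arm w) a<b)

  arm-132 : arm (a ∷ c ∷ b ∷ w) ≡ arm (a ∷ w)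
  arm-132 = trans (settle-absorb-larger false false (arm (b ∷ w)) (<-trans a<b b<c))
                  (settle-absorb-larger true false (arm w) a<b)

  arm-231 : arm (b ∷ c ∷ a ∷ w) ≡ arm (a ∷ w)
  arm-231 = trans (settle-absorb-larger false false (arm (a ∷ w)) b<c)
                  (settle-odd-above false (arm w) a<b)

arm-++ˡ : ∀ p {v w} → arm v ≡ arm w → arm (p ++ v) ≡ arm (p ++ w)
arm-++ˡ p {v} {w} eq = begin
  arm (p ++ v)                     ≡⟨ foldr-++ (settle false) [] p v ⟩
  foldr (settle false) (arm v) p   ≡⟨ cong (λ s → foldr (settle false) s p) eq ⟩
  foldr (settle false) (arm w) p   ≡⟨ foldr-++ (settle false) [] p w ⟨
  arm (p ++ w)                     ∎
  where open ≡-Reasoning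

settle-All : ∀ {P : ℕ → Set} p {x s} → P x → All P s → All P (settle p x s)
settle-All p {x} px [] = px ∷ []
settle-All p {x} {d ∷ s} px (pd ∷ ps) with d <? x
settle-All false px (pd ∷ ps) | yes _ = px ∷ pd ∷ ps
settle-All true  px (pd ∷ ps) | yes _ = pd ∷ ps
settle-All p     px (pd ∷ ps) | no  _ = settle-All (not p) px ps

arm-All : ∀ {P : ℕ → Set} {w} → All P w → All P (arm w)
arm-All []         = []
arm-All (px ∷ pxs) = settle-All false px (arm-All pxs)

arm-⊆ : ∀ w → arm w ⊆ w
arm-⊆ w = All.lookup (arm-All (All.tabulate (λ x∈w → x∈w)))

------------------------------------------------------------------------
-- Words with distinct letters

-- A strictly sorted list is determined by its set of members.
AllPairs-unique : ∀ {R : Rel ℕ 0ℓ} → Asymmetric R → ∀ {xs ys} →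
  AllPairs R xs → AllPairs R ys → xs ⊆ ys → ys ⊆ xs → xs ≡ ys
AllPairs-unique asym []       []       _     _     = refl
AllPairs-unique asym []       (_ ∷ _)  _     ys⊆xs with () ← ys⊆xs (here refl)
AllPairs-unique asym (_ ∷ _)  []       xs⊆ys _     with () ← xs⊆ys (here refl)
AllPairs-unique {R} asym {x ∷ xs} {y ∷ ys} (rx ∷ rxs) (ry ∷ rys) xs⊆ys ys⊆xs = go x≡y
  where
  x≡y : x ≡ y
  x≡y with xs⊆ys (here refl) | ys⊆xs (here refl)
  ... | here eq    | _          = eq
  ... | there _    | here eq    = sym eq
  ... | there x∈ys | there y∈xs = ⊥-elim (asym (All.lookup rx y∈xs) (All.lookup ry x∈ys))

  strengthen : ∀ {z us vs} → All (R z) us → z ∷ us ⊆ z ∷ vs → us ⊆ vs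
  strengthen rz sub u∈us with sub (there u∈us)
  ... | here refl  = ⊥-elim (asym (All.lookup rz u∈us) (All.lookup rz u∈us))
  ... | there u∈vs = u∈vs

  go : x ≡ y → x ∷ xs ≡ y ∷ ys
  go refl = cong (x ∷_) (AllPairs-unique asym rxs rys (strengthen rx xs⊆ys) (strengthen ry ys⊆xs))

Unique-++-disjoint : ∀ {xs ys : Word} → Unique (xs ++ ys) → ∀ {x} → x ∈ xs → x ∉ ys
Unique-++-disjoint {_ ∷ xs} (ne ∷ _) (here refl) x∈ys = All.lookup ne (∈-++⁺ʳ xs x∈ys) refl
Unique-++-disjoint (_ ∷ u) (there x∈xs) x∈ys = Unique-++-disjoint u x∈xs x∈ys

Unique-++ʳ : ∀ (xs : Word) {ys} → Unique (xs ++ ys) → Unique ys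
Unique-++ʳ []       u       = u
Unique-++ʳ (_ ∷ xs) (_ ∷ u) = Unique-++ʳ xs u

-- If two words agree outside a window and every letter of the first, all distinct,
-- occurs in the second, then this also holds for the letters inside the window.
middle-⊆ : ∀ (a : Word) {u v b} → Unique (a ++ u ++ b) →
  a ++ u ++ b ⊆ a ++ v ++ b → u ⊆ v
middle-⊆ a {u} {v} distinct sub x∈u with ∈-++⁻ a (sub (∈-++⁺ʳ a (∈-++⁺ˡ x∈u)))
... | inj₁ x∈a = ⊥-elim (Unique-++-disjoint distinct x∈a (∈-++⁺ˡ x∈u))
... | inj₂ x∈vb with ∈-++⁻ v x∈vb
...   | inj₁ x∈v = x∈v
...   | inj₂ x∈b = ⊥-elim (Unique-++-disjoint (Unique-++ʳ a distinct) x∈u x∈b)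

tabulate-injective : ∀ {A : Set} {n} {f g : Fin n → A} → tabulate f ≡ tabulate g → ∀ i → f i ≡ g i
tabulate-injective eq fzero    = ∷-injectiveˡ eq
tabulate-injective eq (fsuc i) = tabulate-injective (∷-injectiveʳ eq) i

tabulate-∷ʳ : ∀ {A : Set} (f : ℕ → A) n →
  tabulate {n = n} (λ i → f (toℕ i)) ∷ʳ f n ≡ tabulate {n = suc n} (λ i → f (toℕ i))
tabulate-∷ʳ f zero    = refl
tabulate-∷ʳ f (suc n) = cong (f 0 ∷_) (tabulate-∷ʳ (λ k → f (suc k)) n)

------------------------------------------------------------------------
-- Permutations and their words
oneLine-injective : ∀ {n} {π ρ : Permutation′ n} → oneLine π ≡ oneLine ρ → π ≈ ρ
oneLine-injective eq i = Fin.toℕ-injective (suc-injective (tabulate-injective eq i))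

oneLine-positive : ∀ {n} (π : Permutation′ n) → All (0 <_) (oneLine π)
oneLine-positive π = All.tabulate⁺ {f = λ i → suc (toℕ (π ⟨$⟩ʳ i))} (λ _ → z<s)

oneLine-Unique : ∀ {n} (π : Permutation′ n) → Unique (oneLine π)
oneLine-Unique π = Unique.tabulate⁺ λ {i} {j} eq → begin
  i                      ≡⟨ inverseˡ π ⟨
  π ⟨$⟩ˡ (π ⟨$⟩ʳ i)      ≡⟨ cong (π ⟨$⟩ˡ_) (Fin.toℕ-injective (suc-injective eq)) ⟩
  π ⟨$⟩ˡ (π ⟨$⟩ʳ j)      ≡⟨ inverseˡ π ⟩
  j                      ∎
  where open ≡-Reasoning

letter∈oneLine : ∀ {n} (π : Permutation′ n) k → suc (toℕ k) ∈ oneLine π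
letter∈oneLine π k = subst (λ j → suc (toℕ j) ∈ oneLine π) (inverseʳ π) (∈-tabulate⁺ (π ⟨$⟩ˡ k))

oneLine-⊆ : ∀ {n} (π ρ : Permutation′ n) → oneLine π ⊆ oneLine ρ
oneLine-⊆ π ρ x∈π with i , refl ← ∈-tabulate⁻ x∈π = letter∈oneLine ρ (π ⟨$⟩ʳ i)

-- A rearrangement of a list is given by a permutation of its positions.  The
-- equation in place of the index tabulate f makes the induction possible.
rearrangement : ∀ {A : Set} {n} {xs ys : List A} (f : Fin n → A) → xs ↭ ys → ys ≡ tabulate f →
  Σ[ σ ∈ Permutation′ n ] xs ≡ tabulate (λ i → f (σ ⟨$⟩ʳ i))
rearrangement f _↭_.refl eq = id , eq
rearrangement {n = suc _} f (_↭_.prep x p) eq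
  with σ , eq′ ← rearrangement (f ∘ fsuc) p (∷-injectiveʳ eq)
  = lift₀ σ , cong₂ _∷_ (∷-injectiveˡ eq) eq′
rearrangement {n = suc (suc _)} f (_↭_.swap x y p) eq
  with σ , eq′ ← rearrangement (f ∘ fsuc ∘ fsuc) p (∷-injectiveʳ (∷-injectiveʳ eq))
  = swap σ , cong₂ _∷_ (∷-injectiveˡ (∷-injectiveʳ eq)) (cong₂ _∷_ (∷-injectiveˡ eq) eq′)
rearrangement f (_↭_.trans p q) eq
  with σ , eq′ ← rearrangement f q eq
  with τ , eq″ ← rearrangement (λ i → f (σ ⟨$⟩ʳ i)) p eq′
  = τ ∘ₚ σ , eq″

-- Every rearrangement of the word of a permutation is the word of a permutation.
oneLine-onto : ∀ {n} (π : Permutation′ n) {w} → w ↭ oneLine π →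
  Σ[ ρ ∈ Permutation′ n ] oneLine ρ ≡ w
oneLine-onto π p with σ , eq ← rearrangement _ p refl = σ ∘ₚ π , sym eq

------------------------------------------------------------------------
-- Order permutations
StrictlyIncreasing : ∀ {c} → (Fin c → ℕ) → Set
StrictlyIncreasing s = ∀ {i j} → i <ᶠ j → s i < s j

-- A word with order permutation σ is its sorted word s read along σ.
increasing-rearrangement : ∀ {c} {u : Vec ℕ c} {σ} → IsOrderPermutation u σ →
  Σ[ s ∈ (Fin c → ℕ) ] StrictlyIncreasing s × (∀ i → lookup u i ≡ s (σ ⟨$⟩ʳ i))
increasing-rearrangement {u = u} {σ} ord =
    (λ k → lookup u (σ ⟨$⟩ˡ k))
  , (λ {i} {j} i<j → Equivalence.to (ord _ _) (subst₂ _<ᶠ_ (sym (inverseʳ σ)) (sym (inverseʳ σ)) i<j))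
  , (λ i → cong (lookup u) (sym (inverseˡ σ)))

isOrderPermutation : ∀ {c} (u : Vec ℕ c) (s : Fin c → ℕ) (σ : Permutation′ c) →
  StrictlyIncreasing s → (∀ i → lookup u i ≡ s (σ ⟨$⟩ʳ i)) → IsOrderPermutation u σ
isOrderPermutation u s σ inc eq i j = mk⇔
  (λ lt → subst₂ _<_ (sym (eq i)) (sym (eq j)) (inc lt))
  (λ lt → reflect (subst₂ _<_ (eq i) (eq j) lt))
  where
  reflect : ∀ {k l} → s k < s l → k <ᶠ l
  reflect {k} {l} lt with Fin.<-cmp k l
  ... | tri< k<l _ _ = k<l
  ... | tri≈ _ refl _ = ⊥-elim (<-irrefl refl lt)
  ... | tri> _ _ l<k = ⊥-elim (<-asym lt (inc l<k))

increasing-unique : ∀ {c} {s t : Fin c → ℕ} → StrictlyIncreasing s → StrictlyIncreasing t →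
  tabulate s ⊆ tabulate t → tabulate t ⊆ tabulate s → ∀ i → s i ≡ t i
increasing-unique incs inct s⊆t t⊆s = tabulate-injective
  (AllPairs-unique {_<_} <-asym (AllPairs.tabulate⁺-< incs) (AllPairs.tabulate⁺-< inct) s⊆t t⊆s)

module _ {c} (u : Vec ℕ c) (s : Fin c → ℕ) (σ : Permutation′ c)
         (eq : ∀ i → lookup u i ≡ s (σ ⟨$⟩ʳ i)) where

  letters⊆values : toList u ⊆ tabulate s
  letters⊆values x∈u
    with x∈u′ ← ∈-toList⁻ x∈u
    rewrite VecAny.lookup-index x∈u′ | eq (VecAny.index x∈u′)
    = ∈-tabulate⁺ _

  values⊆letters : tabulate s ⊆ toList u
  values⊆letters x∈s with k , refl ← ∈-tabulate⁻ x∈s =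
    subst (_∈ toList u) (trans (eq (σ ⟨$⟩ˡ k)) (cong s (inverseʳ σ)))
      (∈-toList⁺ (∈-lookup (σ ⟨$⟩ˡ k) u))

------------------------------------------------------------------------
-- Invariance under replacement

-- The words of the only part of K with more than one element.
patterns : List Word
patterns = (1 ∷ 2 ∷ 3 ∷ []) ∷ (1 ∷ 3 ∷ 2 ∷ []) ∷ (2 ∷ 3 ∷ 1 ∷ []) ∷ []

σ₁₃₂ : Permutation′ 3
σ₁₃₂ = transpose 1F 2F

σ₂₃₁ : Permutation′ 3
σ₂₃₁ = transpose 0F 1F ∘ₚ transpose 0F 2F

toList-tabulate : ∀ {c} (u : Vec ℕ c) → toList u ≡ tabulate (lookup u)
toList-tabulate Vec.[]      = refl
toList-tabulate (x Vec.∷ u) = cong (x ∷_) (toList-tabulate u)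

-- Equality of oneLine σ and oneLine τ makes σ and τ agree pointwise, so a word
-- read along σ can be read along τ.
letters-along : ∀ {c} (u : Vec ℕ c) (s : Fin c → ℕ) (σ τ : Permutation′ c) →
  (∀ i → lookup u i ≡ s (σ ⟨$⟩ʳ i)) → oneLine σ ≡ oneLine τ →
  toList u ≡ tabulate (λ i → s (τ ⟨$⟩ʳ i))
letters-along u s σ τ eq same = trans (toList-tabulate u)
  (tabulate-cong (λ i → trans (eq i) (cong s (oneLine-injective {π = σ} {τ} same i))))

-- A window whose pattern is 123, 132 or 231 acts as its least letter.
arm-pattern : ∀ (u : Vec ℕ 3) (s : Fin 3 → ℕ) (σ : Permutation′ 3) → StrictlyIncreasing s →
  (∀ i → lookup u i ≡ s (σ ⟨$⟩ʳ i)) → oneLine σ ∈ patterns →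
  ∀ w → arm (toList u ++ w) ≡ arm (s 0F ∷ w)
arm-pattern u s σ inc eq σ∈P w = go σ∈P
  where
  s₀<s₁ : s 0F < s 1F
  s₀<s₁ = inc z<s
  s₁<s₂ : s 1F < s 2F
  s₁<s₂ = inc (s<s z<s)
  word : ∀ τ → oneLine σ ≡ oneLine τ → toList u ≡ tabulate (λ i → s (τ ⟨$⟩ʳ i))
  word τ = letters-along u s σ τ eq
  go : oneLine σ ∈ patterns → arm (toList u ++ w) ≡ arm (s 0F ∷ w)
  go (here e)                 rewrite word id e   = arm-123 s₀<s₁ s₁<s₂ w
  go (there (here e))         rewrite word σ₁₃₂ e = arm-132 s₀<s₁ s₁<s₂ w
  go (there (there (here e))) rewrite word σ₂₃₁ e = arm-231 s₀<s₁ s₁<s₂ w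

-- The two windows have the same letters, hence the same sorted word.  If their
-- order permutations coincide, so do the windows; otherwise both act as their
-- common least letter.
arm-Replacement : ∀ {n} {φ ψ : Permutation′ n} → Replacement K φ ψ →
  arm (oneLine φ) ≡ arm (oneLine ψ)
arm-Replacement {φ = φ} {ψ} (a , b , u , v , σ , τ , eφ , eψ , ordu , ordv , same)
  with s , incs , eu ← increasing-rearrangement {u = u} {σ} ordu
     | t , inct , ev ← increasing-rearrangement {u = v} {τ} ordv
  rewrite eφ | eψ = arm-++ˡ a (window same)
  where
  u⊆v : toList u ⊆ toList v
  u⊆v = middle-⊆ a (subst Unique eφ (oneLine-Unique φ)) (subst₂ _⊆_ eφ eψ (oneLine-⊆ φ ψ))
  v⊆u : toList v ⊆ toList u
  v⊆u = middle-⊆ a (subst Unique eψ (oneLine-Unique ψ)) (subst₂ _⊆_ eψ eφ (oneLine-⊆ ψ φ))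
  s≗t : ∀ i → s i ≡ t i
  s≗t = increasing-unique incs inct
    (λ x∈s → letters⊆values v t τ ev (u⊆v (values⊆letters u s σ eu x∈s)))
    (λ x∈t → letters⊆values u s σ eu (v⊆u (values⊆letters v t τ ev x∈t)))
  window : ReplacementPartition.SamePart K σ τ → arm (toList u ++ b) ≡ arm (toList v ++ b)
  window (inj₁ σ≡τ) = cong (λ w → arm (w ++ b)) (begin
    toList u                           ≡⟨ letters-along u s σ τ eu σ≡τ ⟩
    tabulate (λ i → s (τ ⟨$⟩ʳ i))      ≡⟨ tabulate-cong (λ i → s≗t (τ ⟨$⟩ʳ i)) ⟩
    tabulate (λ i → t (τ ⟨$⟩ʳ i))      ≡⟨ letters-along v t τ τ ev refl ⟨
    toList v                           ∎)
    where open ≡-Reasoning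
  window (inj₂ (σ∈P , τ∈P)) = begin
    arm (toList u ++ b)   ≡⟨ arm-pattern u s σ incs eu σ∈P b ⟩
    arm (s 0F ∷ b)        ≡⟨ cong (λ x → arm (x ∷ b)) (s≗t 0F) ⟩
    arm (t 0F ∷ b)        ≡⟨ arm-pattern v t τ inct ev τ∈P b ⟨
    arm (toList v ++ b)   ∎
    where open ≡-Reasoning

------------------------------------------------------------------------
-- Valleys

-- Words that first fall and then rise; either stretch may be trivial.
data Valley : Word → Set where
  ascending  : ∀ {w} → Linked _<_ w → Valley w
  descending : ∀ {x y w} → y < x → Valley (y ∷ w) → Valley (x ∷ y ∷ w)

-- The word w consists of the falling word s and a rising word, each of whose
-- letters is larger than some letter of s.
record FallRise (w s : Word) : Set where
  constructor fall-rise
  field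
    {rising} : Word
    word≡    : w ≡ s ++ rising
    falls    : Linked _>_ s
    rises    : Linked _<_ rising
    above    : All (λ y → Any (_< y) s) rising

open FallRise

arm-ascending : ∀ {x w} → Linked _<_ (x ∷ w) → arm (x ∷ w) ≡ [ x ]
arm-ascending [-]                                 = refl
arm-ascending (x<y ∷ l) rewrite arm-ascending l = settle-larger [] (<⇒≤ x<y)

ascending-head : ∀ {x} {w : Word} → Linked _<_ (x ∷ w) → All (x <_) w
ascending-head l with x<w ∷ _ ← Linked⇒AllPairs <-trans l = x<w

valley-split : ∀ {x w} → Valley (x ∷ w) →
  ∃[ s ] arm (x ∷ w) ≡ x ∷ s × FallRise (x ∷ w) (x ∷ s)
valley-split (ascending l) =
  [] , arm-ascending l , fall-rise refl [-] (Linked.tail l) (All.map here (ascending-head l))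
valley-split {x} (descending {y = y} y<x v)
  with s , arm≡ , fall-rise word≡ falls rises above ← valley-split v
  = y ∷ s
  , trans (cong (settle false x) arm≡) (settle-smaller s y<x)
  , fall-rise (cong (x ∷_) word≡) (y<x ∷ falls) rises (All.map there above)

valley-arm : ∀ {x w} → Valley (x ∷ w) → FallRise (x ∷ w) (arm (x ∷ w))
valley-arm v with _ , arm≡ , fr ← valley-split v = subst (FallRise _) (sym arm≡) fr

FallRise-unique : ∀ {v w s} → FallRise v s → FallRise w s → Unique v → Unique w →
  v ⊆ w → w ⊆ v → v ≡ w
FallRise-unique {s = s} (fall-rise refl _ rv _) (fall-rise refl _ rw _) uv uw v⊆w w⊆v =
  cong (s ++_) (AllPairs-unique {_<_} <-asym
    (Linked⇒AllPairs <-trans rv) (Linked⇒AllPairs <-trans rw)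
    (rest⊆ uv v⊆w) (rest⊆ uw w⊆v))
  where
  rest⊆ : ∀ {e f} → Unique (s ++ e) → s ++ e ⊆ s ++ f → e ⊆ f
  rest⊆ distinct sub x∈e with ∈-++⁻ s (sub (∈-++⁺ʳ s x∈e))
  ... | inj₁ x∈s = ⊥-elim (Unique-++-disjoint distinct x∈s x∈e)
  ... | inj₂ x∈f = x∈f

-- A letter 1 among the rising letters would lie above a smaller positive letter.
1∈fall : ∀ {w s} → FallRise w s → All (0 <_) w → 1 ∈ w → 1 ∈ s
1∈fall {s = s} (fall-rise refl _ _ above) pos 1∈w with ∈-++⁻ s 1∈w
... | inj₁ 1∈s = 1∈s
... | inj₂ 1∈e = ⊥-elim (absurd (All.++⁻ˡ s pos) (All.lookup above 1∈e))
  where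
  absurd : ∀ {s} → All (0 <_) s → Any (_< 1) s → ⊥
  absurd (0<d ∷ _) (here d<1)  = <⇒≱ d<1 0<d
  absurd (_ ∷ pos) (there any) = absurd pos any

------------------------------------------------------------------------
-- Reduction to a valley

-- A letter of w larger than both of its neighbours.
record Peak (w : Word) : Set where
  constructor peak
  field
    before : Word
    {x y z} : ℕ
    after  : Word
    word≡  : w ≡ before ++ x ∷ y ∷ z ∷ after
    x<y    : x < y
    z<y    : z < y

valley-or-peak : ∀ w → Unique w → Valley w ⊎ Peak w
valley-or-peak []      _ = inj₁ (ascending [])
valley-or-peak (x ∷ w) (x∉w ∷ u) with valley-or-peak w u
... | inj₂ (peak before after eq x<y z<y) = inj₂ (peak (x ∷ before) after (cong (x ∷_) eq) x<y z<y)
... | inj₁ (ascending []) = inj₁ (ascending [-])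
... | inj₁ v@(ascending {y ∷ _} l) with <-cmp x y
...   | tri< x<y _ _ = inj₁ (ascending (x<y ∷ l))
...   | tri≈ _ x≡y _ = contradiction x≡y (All.head x∉w)
...   | tri> _ _ y<x = inj₁ (descending y<x v)
valley-or-peak (x ∷ w) (x∉w ∷ u) | inj₁ v@(descending {y} z<y _) with <-cmp x y
...   | tri< x<y _ _ = inj₂ (peak [] _ refl x<y z<y)
...   | tri≈ _ x≡y _ = contradiction x≡y (All.head x∉w)
...   | tri> _ _ y<x = inj₁ (descending y<x v)

-- The sum of the letters, each multiplied by the number of letters to its right.
-- It drops when two adjacent letters are put in ascending order.
weight : Word → ℕ
weight []      = 0
weight (x ∷ w) = x * length w + weight w

weight-swap : ∀ {y z} w → z < y → weight (z ∷ y ∷ w) < weight (y ∷ z ∷ w)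
weight-swap {y} {z} w z<y = subst₂ _<_ (lhs y z (length w) (weight w)) (rhs y z (length w) (weight w))
  (+-monoˡ-< (y * length w + z * length w + weight w) z<y)
  where
  lhs : ∀ y z l k → z + (y * l + z * l + k) ≡ z * suc l + (y * l + k)
  lhs = solve-∀
  rhs : ∀ y z l k → y + (y * l + z * l + k) ≡ y * suc l + (z * l + k)
  rhs = solve-∀

weight-++ˡ : ∀ p {v w} → length v ≡ length w → weight v < weight w → weight (p ++ v) < weight (p ++ w)
weight-++ˡ [] len lt = lt
weight-++ˡ (x ∷ p) {v} {w} len lt
  rewrite length-++ p {v} | length-++ p {w} | len = +-monoʳ-< _ (weight-++ˡ p len lt)

increasing₃ : ∀ {a b c} → a < b → b < c → StrictlyIncreasing (lookup (a Vec.∷ b Vec.∷ c Vec.∷ Vec.[]))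
increasing₃ a<b b<c {0F} {1F} _ = a<b
increasing₃ a<b b<c {0F} {2F} _ = <-trans a<b b<c
increasing₃ a<b b<c {1F} {2F} _ = b<c
increasing₃ a<b b<c {1F} {1F} (s<s ())
increasing₃ a<b b<c {2F} {1F} (s<s ())
increasing₃ a<b b<c {2F} {2F} (s<s (s<s ()))

-- K-equivalence on S_n.
infix 4 _∼_
_∼_ : ∀ {n} → Rel (Permutation′ n) 0ℓ
_∼_ {n} = Setoid._≈_ (K-Equivalence K n)

-- A permutation of smaller weight obtained from π by one replacement.
record Lowering {n} (π : Permutation′ n) : Set where
  constructor lowering
  field
    result  : Permutation′ n
    related : Replacement K π result
    lighter : weight (oneLine result) < weight (oneLine π)

-- The letters of the peak are sorted: 132 becomes 123 by one adjacent swap, 231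
-- by two, each of which lowers the weight.
straighten : ∀ {n} (π : Permutation′ n) → Peak (oneLine π) → Lowering π
straighten π (peak before {x} {y} {z} after word≡ x<y z<y) with <-cmp x z
... | tri< x<z _ _
  with ρ , eq ← oneLine-onto π (subst (before ++ x ∷ z ∷ y ∷ after ↭_) (sym word≡)
    (++⁺ˡ before (↭-prep x (↭-swap z y ↭-refl))))
  = lowering ρ
      ( before , after , u , v , σ₁₃₂ , id
      , word≡ , eq
      , isOrderPermutation u (lookup v) σ₁₃₂ inc (λ { 0F → refl ; 1F → refl ; 2F → refl })
      , isOrderPermutation v (lookup v) id inc (λ _ → refl)
      , inj₂ (there (here refl) , here refl))
      (subst₂ (λ v w → weight v < weight w) (sym eq) (sym word≡)
        (weight-++ˡ before refl (+-monoʳ-< (x * length (y ∷ z ∷ after)) (weight-swap after z<y))))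
  where
  u v : Vec ℕ 3
  u = x Vec.∷ y Vec.∷ z Vec.∷ Vec.[]
  v = x Vec.∷ z Vec.∷ y Vec.∷ Vec.[]
  inc : StrictlyIncreasing (lookup v)
  inc = increasing₃ x<z z<y
... | tri> _ _ z<x
  with ρ , eq ← oneLine-onto π (subst (before ++ z ∷ x ∷ y ∷ after ↭_) (sym word≡)
    (++⁺ˡ before (↭-trans (↭-swap z x ↭-refl) (↭-prep x (↭-swap z y ↭-refl)))))
  = lowering ρ
      ( before , after , u , v , σ₂₃₁ , id
      , word≡ , eq
      , isOrderPermutation u (lookup v) σ₂₃₁ inc (λ { 0F → refl ; 1F → refl ; 2F → refl })
      , isOrderPermutation v (lookup v) id inc (λ _ → refl)
      , inj₂ (there (there (here refl)) , here refl))
      (subst₂ (λ v w → weight v < weight w) (sym eq) (sym word≡)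
        (weight-++ˡ before refl (<-trans (weight-swap (y ∷ after) z<x)
          (+-monoʳ-< (x * length (y ∷ z ∷ after)) (weight-swap after z<y)))))
  where
  u v : Vec ℕ 3
  u = x Vec.∷ y Vec.∷ z Vec.∷ Vec.[]
  v = z Vec.∷ x Vec.∷ y Vec.∷ Vec.[]
  inc : StrictlyIncreasing (lookup v)
  inc = increasing₃ z<x x<y
... | tri≈ _ refl _ with (_ ∷ x≢x ∷ _) ∷ _ ← Unique-++ʳ before (subst Unique word≡ (oneLine-Unique π))
  = contradiction refl x≢x

normalise : ∀ {n} (π : Permutation′ n) → ∃[ ρ ] π ∼ ρ × Valley (oneLine ρ)
normalise π = go π (<-wellFounded _)
  where
  go : ∀ {n} (π : Permutation′ n) → Acc _<_ (weight (oneLine π)) →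
       ∃[ ρ ] π ∼ ρ × Valley (oneLine ρ)
  go {n} π (acc smaller) with valley-or-peak (oneLine π) (oneLine-Unique π)
  ... | inj₁ v = π , Setoid.refl (K-Equivalence K n) {π} , v
  ... | inj₂ p
    with lowering ρ related lighter ← straighten π p
    with χ , ρ∼χ , v ← go ρ (smaller lighter)
    = χ , Setoid.trans (K-Equivalence K n) (EqClosure.return (inj₂ related)) ρ∼χ , v

------------------------------------------------------------------------
-- Valleys with prescribed falling arm

-- The valley on 1, …, k + 1 whose arm contains the letter i + 2 exactly when g i
-- is true.  The letters are added in ascending order, each as new largest letter
-- at the left or at the right end.
valleyWord : (ℕ → Bool) → ℕ → Word
valleyWord g zero    = [ 1 ]
valleyWord g (suc k) = if g k then 2 + k ∷ valleyWord g k else valleyWord g k ∷ʳ (2 + k)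

arm-∷ : ∀ {M w} → All (_< M) w → arm (M ∷ w) ≡ M ∷ arm w
arm-∷ {M} {w} w<M with arm w | arm-All w<M
... | []    | _        = refl
... | _ ∷ s | d<M ∷ _ = settle-smaller s d<M

arm-∷ʳ : ∀ {M w} → All (_< M) w → w ≢ [] → arm (w ∷ʳ M) ≡ arm w
arm-∷ʳ {w = []}        _            w≢[] = contradiction refl w≢[]
arm-∷ʳ {w = x ∷ []}    (x<M ∷ _)    _    = settle-larger [] (<⇒≤ x<M)
arm-∷ʳ {w = x ∷ y ∷ w} (_ ∷ y∷w<M)  _    = cong (settle false x) (arm-∷ʳ y∷w<M (λ ()))

module _ (g : ℕ → Bool) where

  valleyWord-bounded : ∀ k → All (_< 2 + k) (valleyWord g k)
  valleyWord-bounded zero = ≤-refl ∷ []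
  valleyWord-bounded (suc k) with g k | All.map m<n⇒m<1+n (valleyWord-bounded k)
  ... | true  | ih = ≤-refl ∷ ih
  ... | false | ih = All.++⁺ ih (≤-refl ∷ [])

  valleyWord-≢[] : ∀ k → valleyWord g k ≢ []
  valleyWord-≢[] (suc k) eq with g k | valleyWord g k
  valleyWord-≢[] (suc k) () | true  | _
  valleyWord-≢[] (suc k) () | false | []
  valleyWord-≢[] (suc k) () | false | _ ∷ _

  valleyWord-↭ : ∀ k → valleyWord g k ↭ tabulate {n = suc k} (λ i → suc (toℕ i))
  valleyWord-↭ zero = ↭-refl
  valleyWord-↭ (suc k) rewrite sym (tabulate-∷ʳ suc (suc k)) with g k
  ... | true  = ↭-trans (↭-prep (2 + k) (valleyWord-↭ k)) (∷↭∷ʳ (2 + k) _)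
  ... | false = ++⁺ʳ [ 2 + k ] (valleyWord-↭ k)

  valleyWord-arm : ∀ {k m} → k < m → does (2 + k ∈? arm (valleyWord g m)) ≡ g k
  valleyWord-arm {k} {suc m} k<1+m with g m in gm | m<1+n⇒m<n∨m≡n k<1+m
  ... | true | inj₂ refl rewrite arm-∷ (valleyWord-bounded m) =
    trans (dec-true (2 + m ∈? 2 + m ∷ arm (valleyWord g m)) (here refl)) (sym gm)
  ... | true | inj₁ k<m rewrite arm-∷ (valleyWord-bounded m) =
    trans (does-⇔ (mk⇔ drop there) (2 + k ∈? 2 + m ∷ arm (valleyWord g m)) (2 + k ∈? arm (valleyWord g m)))
      (valleyWord-arm k<m)
    where
    drop : 2 + k ∈ 2 + m ∷ arm (valleyWord g m) → 2 + k ∈ arm (valleyWord g m)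
    drop (here refl) = ⊥-elim (<-irrefl refl k<m)
    drop (there p)   = p
  ... | false | inj₂ refl rewrite arm-∷ʳ (valleyWord-bounded m) (valleyWord-≢[] m) =
    trans (dec-false (2 + m ∈? arm (valleyWord g m))
      (λ M∈arm → <-irrefl refl (All.lookup (arm-All (valleyWord-bounded m)) M∈arm))) (sym gm)
  ... | false | inj₁ k<m rewrite arm-∷ʳ (valleyWord-bounded m) (valleyWord-≢[] m) =
    valleyWord-arm k<m

------------------------------------------------------------------------
-- Counting
funToFin-cong : ∀ {m n} {f g : Fin m → Fin n} → (∀ i → f i ≡ g i) → funToFin f ≡ funToFin g
funToFin-cong {zero}  eq = refl
funToFin-cong {suc m} eq = cong₂ combine (eq fzero) (funToFin-cong (λ i → eq (fsuc i)))

bit : Bool → Fin 2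
bit = Inverse.from Fin.2↔Bool

-- Whether the letter k + 2 belongs to the arm.  The letter 1 always does, so it
-- carries no information.
inArm : ∀ {n} → Permutation′ n → ℕ → Bool
inArm π k = does (2 + k ∈? arm (oneLine π))

-- The number whose m binary digits are the membership bits of 2, …, m + 1.
classOf : ∀ {m} → Permutation′ (suc m) → Fin (2 ^ m)
classOf {m} π = funToFin {m} (λ k → bit (inArm π (toℕ k)))

arm-∼ : ∀ {n} {π ρ : Permutation′ n} → π ∼ ρ → arm (oneLine π) ≡ arm (oneLine ρ)
arm-∼ {n} = EqClosure.gfold isEquivalence (λ π → arm (oneLine π)) λ {π} {ρ} → generator π ρ
  where
  generator : ∀ (π ρ : Permutation′ n) → π ≈ ρ ⊎ Replacement K π ρ → arm (oneLine π) ≡ arm (oneLine ρ)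
  generator π ρ (inj₁ π≈ρ) = cong arm (tabulate-cong (λ i → cong (λ k → suc (toℕ k)) (π≈ρ i)))
  generator π ρ (inj₂ r)   = arm-Replacement {φ = π} {ρ} r

classOf-cong : ∀ {m} {π ρ : Permutation′ (suc m)} → π ∼ ρ → classOf π ≡ classOf ρ
classOf-cong {m} {π} {ρ} π∼ρ =
  cong (λ s → funToFin {m} (λ k → bit (does (2 + toℕ k ∈? s)))) (arm-∼ {π = π} {ρ} π∼ρ)

classOf-inArm : ∀ {m} (π ρ : Permutation′ (suc m)) → classOf π ≡ classOf ρ →
  ∀ (k : Fin m) → inArm π (toℕ k) ≡ inArm ρ (toℕ k)
classOf-inArm {m} π ρ eq k = begin
  inArm π (toℕ k)                                         ≡⟨ Inverse.inverseˡ Fin.2↔Bool refl ⟨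
  Inverse.to Fin.2↔Bool (bit (inArm π (toℕ k)))          ≡⟨ cong (Inverse.to Fin.2↔Bool) same-bit ⟩
  Inverse.to Fin.2↔Bool (bit (inArm ρ (toℕ k)))          ≡⟨ Inverse.inverseˡ Fin.2↔Bool refl ⟩
  inArm ρ (toℕ k)                                         ∎
  where
  open ≡-Reasoning
  same-bit : bit (inArm π (toℕ k)) ≡ bit (inArm ρ (toℕ k))
  same-bit = begin
    bit (inArm π (toℕ k))                               ≡⟨ Fin.finToFun-funToFin (λ k → bit (inArm π (toℕ k))) k ⟨
    finToFun (classOf π) k                              ≡⟨ cong (λ c → finToFun {2} {m} c k) eq ⟩
    finToFun (classOf ρ) k                              ≡⟨ Fin.finToFun-funToFin (λ k → bit (inArm ρ (toℕ k))) k ⟩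
    bit (inArm ρ (toℕ k))                               ∎

valley-arm-⊆ : ∀ {m} (π ρ : Permutation′ (suc m)) → Valley (oneLine ρ) →
  (∀ (k : Fin m) → inArm π (toℕ k) ≡ inArm ρ (toℕ k)) → arm (oneLine π) ⊆ arm (oneLine ρ)
valley-arm-⊆ π ρ v same x∈arm
  with ∈-tabulate⁻ {f = λ i → suc (toℕ (π ⟨$⟩ʳ i))} (arm-⊆ (oneLine π) x∈arm)
... | i , refl with π ⟨$⟩ʳ i
...   | fzero  = 1∈fall (valley-arm v) (oneLine-positive ρ) (letter∈oneLine ρ fzero)
...   | fsuc k = holds (2 + toℕ k ∈? arm (oneLine ρ))
                   (trans (sym (same k)) (dec-true (2 + toℕ k ∈? arm (oneLine π)) x∈arm))
  where
  holds : ∀ {A : Set} (A? : Dec A) → does A? ≡ true → A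
  holds (yes a) _ = a

valley-unique : ∀ {m} (π ρ : Permutation′ (suc m)) → Valley (oneLine π) → Valley (oneLine ρ) →
  classOf π ≡ classOf ρ → π ≈ ρ
valley-unique π ρ vπ vρ eq = oneLine-injective {π = π} {ρ} (FallRise-unique
  (valley-arm vπ)
  (subst (FallRise (oneLine ρ)) (sym same-arm) (valley-arm vρ))
  (oneLine-Unique π) (oneLine-Unique ρ) (oneLine-⊆ π ρ) (oneLine-⊆ ρ π))
  where
  strictly-falls : ∀ {σ} → Valley (oneLine σ) → AllPairs _>_ (arm (oneLine σ))
  strictly-falls v = Linked⇒AllPairs (λ x>y y>z → <-trans y>z x>y) (falls (valley-arm v))
  same-arm : arm (oneLine π) ≡ arm (oneLine ρ)
  same-arm = AllPairs-unique {_>_} <-asym (strictly-falls {π} vπ) (strictly-falls {ρ} vρ)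
    (valley-arm-⊆ π ρ vρ (classOf-inArm π ρ eq))
    (valley-arm-⊆ ρ π vπ (classOf-inArm ρ π (sym eq)))

classOf-injective : ∀ {m} {π ρ : Permutation′ (suc m)} → classOf π ≡ classOf ρ → π ∼ ρ
classOf-injective {m} {π} {ρ} eq
  with π′ , π∼π′ , vπ′ ← normalise π
     | ρ′ , ρ∼ρ′ , vρ′ ← normalise ρ
  = S.trans π∼π′ (S.trans (EqClosure.return (inj₁ (valley-unique π′ ρ′ vπ′ vρ′
      (trans (sym (classOf-cong π∼π′)) (trans eq (classOf-cong ρ∼ρ′)))))) (S.sym ρ∼ρ′))
  where module S = Setoid (K-Equivalence K (suc m))

-- A function on Fin m as one on ℕ; the value false beyond m is never used.
extend : ∀ {m} → (Fin m → Bool) → ℕ → Bool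
extend {m} f k with k <? m
... | yes k<m = f (fromℕ< k<m)
... | no  _   = false

extend-toℕ : ∀ {m} (f : Fin m → Bool) k → extend f (toℕ k) ≡ f k
extend-toℕ {m} f k with toℕ k <? m
... | yes k<m = cong f (Fin.fromℕ<-toℕ k k<m)
... | no  k≮m = contradiction (Fin.toℕ<n k) k≮m

classOf-onto : ∀ {m} (c : Fin (2 ^ m)) → Σ[ π ∈ Permutation′ (suc m) ] classOf π ≡ c
classOf-onto {m} c = realise (oneLine-onto id (valleyWord-↭ g m))
  where
  open ≡-Reasoning
  chosen : Fin m → Bool
  chosen k = Inverse.to Fin.2↔Bool (finToFun c k)
  g : ℕ → Bool
  g = extend chosen
  realise : Σ[ π ∈ Permutation′ (suc m) ] oneLine π ≡ valleyWord g m →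
            Σ[ π ∈ Permutation′ (suc m) ] classOf π ≡ c
  realise (π , eq) = π , (begin
    classOf {m} π                            ≡⟨ funToFin-cong bits ⟩
    funToFin {m} (finToFun c)                ≡⟨ Fin.funToFin-finToFin {m} c ⟩
    c                                        ∎)
    where
    bits : ∀ k → bit (inArm π (toℕ k)) ≡ finToFun c k
    bits k = begin
      bit (does (2 + toℕ k ∈? arm (oneLine π)))        ≡⟨ cong (λ w → bit (does (2 + toℕ k ∈? arm w))) eq ⟩
      bit (does (2 + toℕ k ∈? arm (valleyWord g m)))   ≡⟨ cong bit (valleyWord-arm g (Fin.toℕ<n k)) ⟩
      bit (g (toℕ k))                                  ≡⟨ cong bit (extend-toℕ chosen k) ⟩
      bit (chosen k)                                   ≡⟨ Inverse.inverseʳ Fin.2↔Bool refl ⟩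
      finToFun c k                                     ∎

proposition2p15 : (n : ℕ) → 3 ≤ n → ClassCount (K-Equivalence K n) (2 ^ (n ∸ 1))
proposition2p15 (suc m) _ = record
  { to        = classOf
  ; cong      = classOf-cong
  ; bijective = classOf-injective
              , λ c → let π , eq = classOf-onto c in π , λ ρ∼π → trans (classOf-cong ρ∼π) eq
  }
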